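{- Let $M$ be a matroid on a finite ground set $E$ with rank function $r_M$, let $q$ be a non-zero (complex) number, and let $\bm v=(v_e)_{e\in E}$ and $\bm u=(u_e)_{e\in E}$ be sequences of non-zero (complex) numbers indexed by $E$. Then $$\widetilde Z(M;q,\bm v)=\Big(\prod_{e\in E}\frac{v_e}{u_e}\Big)\sum_{F\subseteq E}\Big(\prod_{e\in F}\Big(\frac{u_e}{v_e}-1\Big)\Big)\,\widetilde Z\big(M-F;q,(u_e)_{e\in E-F}\big).$$
   Context: A matroid $M$ on a finite ground set $E$ is determined by its rank function $r_M:2^E\to\mathbb Z_{\ge 0}$. For a non-zero number $q$ and a sequence $\bm v=(v_e)_{e\in E}$ of numbers, the normalized Potts model partition function of $M$ is $$\widetilde Z(M;q,\bm v)=\sum_{A\subseteq E}q^{ -r_M(A)}\prod_{e\in A}v_e.$$ For $F\subseteq E$, the deletion $M-F$ is the matroid on $E-F$ with rank function $r_{M-F}(A)=r_M(A)$ for all $A\subseteq E-F$. Empty products equal $1$. -}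

module Defs where

open import Algebra.Apartness.Bundles using (HeytingCommutativeRing; HeytingField)
open import Algebra.Bundles using (CommutativeRing)
open import Data.Fin.Base using (Fin; zero; suc)
open import Data.Fin.Subset
  using (Subset; inside; outside; _∈_; _⊆_; _∪_; _∩_; _─_; ∣_∣)
open import Data.Fin.Subset.Properties
  using (⊆-refl; ⊆-trans; p─q⊆p; out⊆; in⊆in)
open import Data.Nat.Base as ℕ using (ℕ; _≤_)
open import Data.Product.Base using (proj₁; proj₂)
open import Data.Vec.Base using ([]; _∷_; here; there)

-- The ground set is an arbitrary subset of an ambient finite set Fin n, so
-- that a matroid and its deletions share elements.  The rank function is
-- meaningful only on subsets of the ground set; its other values are
-- unconstrained.
record Matroid (n : ℕ) : Set where
  field
    ground          : Subset n
    rank            : Subset n → ℕ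
    rank-≤-size     : ∀ {A} → A ⊆ ground → rank A ≤ ∣ A ∣
    rank-mono       : ∀ {A B} → A ⊆ B → B ⊆ ground → rank A ≤ rank B
    rank-submodular : ∀ {A B} → A ⊆ ground → B ⊆ ground →
                      rank (A ∪ B) ℕ.+ rank (A ∩ B) ≤ rank A ℕ.+ rank B

infixl 5 _∖_

_∖_ : ∀ {n} → Matroid n → Subset n → Matroid n
M ∖ F = record
  { ground          = ground ─ F
  ; rank            = rank
  ; rank-≤-size     = λ A⊆ → rank-≤-size (weaken A⊆)
  ; rank-mono       = λ A⊆B B⊆ → rank-mono A⊆B (weaken B⊆)
  ; rank-submodular = λ A⊆ B⊆ → rank-submodular (weaken A⊆) (weaken B⊆)
  }
  where
  open Matroid M

  weaken : ∀ {A} → A ⊆ ground ─ F → A ⊆ ground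
  weaken A⊆ = ⊆-trans A⊆ (p─q⊆p ground F)

-- In a Heyting field "non-zero" means apart from 0#, which is what makes an
-- element invertible.
module Potts {c ℓ₁ ℓ₂} (K : HeytingField c ℓ₁ ℓ₂) where

  open HeytingField K hiding (zero)
  private
    module R = CommutativeRing
      (HeytingCommutativeRing.commutativeRing heytingCommutativeRing)
  open import Algebra.Properties.Semiring.Exp R.semiring using (_^_)
  open import Algebra.Apartness.Properties.HeytingCommutativeRing
    heytingCommutativeRing using (x-0≈x)

  -- The library provides an inverse of x - 0#, which is equal to x.
  inv : (x : Carrier) → x # 0# → Carrier
  inv x x#0 = proj₁ (#⇒invertible x#0)

  inv-inverseʳ : ∀ x (x#0 : x # 0#) → x * inv x x#0 ≈ 1#
  inv-inverseʳ x x#0 =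
    trans (*-congʳ (sym (x-0≈x x))) (proj₂ (proj₂ (#⇒invertible x#0)))

  infix 7 _/_[_]

  _/_[_] : (x y : Carrier) → y # 0# → Carrier
  x / y [ y#0 ] = x * inv y y#0

  ∏ : ∀ {n} (A : Subset n) → (∀ e → e ∈ A → Carrier) → Carrier
  ∏ []            f = 1#
  ∏ (outside ∷ A) f = ∏ A (λ e e∈A → f (suc e) (there e∈A))
  ∏ (inside  ∷ A) f = f zero here * ∏ A (λ e e∈A → f (suc e) (there e∈A))

  -- ∑ E g is the sum of g A over the subsets A of E; when the first element
  -- of the ambient set lies in E, the subsets avoiding it come first.
  ∑ : ∀ {n} (E : Subset n) → (∀ A → A ⊆ E → Carrier) → Carrier
  ∑ []            g = g [] ⊆-refl
  ∑ (outside ∷ E) g = ∑ E (λ A A⊆E → g (outside ∷ A) (out⊆ A⊆E))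
  ∑ (inside  ∷ E) g = ∑ E (λ A A⊆E → g (outside ∷ A) (out⊆ A⊆E))
                    + ∑ E (λ A A⊆E → g (inside ∷ A) (in⊆in A⊆E))

  -- The sequence v is given on the whole ambient set, but only its values on
  -- the ground set of M enter; the negative power is a power of the inverse.
  Z̃ : ∀ {n} → Matroid n → (q : Carrier) → q # 0# → (Fin n → Carrier) → Carrier
  Z̃ M q q#0 v =
    ∑ ground (λ A _ → inv q q#0 ^ rank A * ∏ A (λ e _ → v e))
    where open Matroid M

{-# OPTIONS --safe #-}

-- Put a = v/u and x = u/v − 1, so that a (1 + x) = 1 and a u = v.  Induct on
-- the ambient set: for an element e of E, the sums over the A avoiding e
-- collect the factor a from e ∉ F and a x from e ∈ F, in total a (1 + x) = 1,
-- while those over the A containing e force e ∉ F and collect a u = v.  The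
-- factor q^(- r A) may be any function of A.
module Submission where

open import Defs
open import Algebra.Apartness.Bundles using (HeytingCommutativeRing; HeytingField)
open import Algebra.Bundles using (CommutativeRing)
open import Data.Fin.Base using (Fin; zero; suc)
open import Data.Fin.Subset
  using (Subset; inside; outside; _∈_; _⊆_; _─_)
open import Data.Fin.Subset.Properties using (out⊆; in⊆in)
open import Data.Nat.Base using (ℕ)
open import Data.Vec.Base using ([]; _∷_; here; there)
import Algebra.Properties.AbelianGroup as AbelianGroupProperties
import Algebra.Properties.CommutativeSemigroup as CommutativeSemigroupProperties
import Algebra.Solver.Ring.NaturalCoefficients.Default as Solver
import Relation.Binary.Reasoning.Setoid as SetoidReasoning

module _ {c ℓ₁ ℓ₂} (K : HeytingField c ℓ₁ ℓ₂) where

  open HeytingField K using (_#_; heytingCommutativeRing)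
  open CommutativeRing
    (HeytingCommutativeRing.commutativeRing heytingCommutativeRing)
    hiding (zero)
  open Potts K
  open AbelianGroupProperties +-abelianGroup using (xyx⁻¹≈y)
  open CommutativeSemigroupProperties +-commutativeSemigroup
    using () renaming (interchange to +-interchange)
  open CommutativeSemigroupProperties *-commutativeSemigroup
    using (x∙yz≈y∙xz) renaming (interchange to *-interchange)
  open Solver commutativeSemiring using (solve; _:+_; _:*_; _:=_)
  open SetoidReasoning setoid

  ∑-cong : ∀ {n} (E : Subset n) {g h : ∀ A → A ⊆ E → Carrier} →
           (∀ A (A⊆E : A ⊆ E) → g A A⊆E ≈ h A A⊆E) → ∑ E g ≈ ∑ E h
  ∑-cong []            g≈h = g≈h _ _
  ∑-cong (outside ∷ E) g≈h = ∑-cong E λ A A⊆E → g≈h _ (out⊆ A⊆E)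
  ∑-cong (inside  ∷ E) g≈h = +-cong
    (∑-cong E λ A A⊆E → g≈h _ (out⊆ A⊆E))
    (∑-cong E λ A A⊆E → g≈h _ (in⊆in A⊆E))

  ∑-distrib-+ : ∀ {n} (E : Subset n) (g h : ∀ A → A ⊆ E → Carrier) →
                ∑ E (λ A A⊆E → g A A⊆E + h A A⊆E) ≈ ∑ E g + ∑ E h
  ∑-distrib-+ []            g h = refl
  ∑-distrib-+ (outside ∷ E) g h = ∑-distrib-+ E _ _
  ∑-distrib-+ (inside  ∷ E) g h = trans
    (+-cong (∑-distrib-+ E _ _) (∑-distrib-+ E _ _))
    (+-interchange _ _ _ _)

  *-distribˡ-∑ : ∀ {n} (E : Subset n) k (g : ∀ A → A ⊆ E → Carrier) →
                 ∑ E (λ A A⊆E → k * g A A⊆E) ≈ k * ∑ E g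
  *-distribˡ-∑ []            k g = refl
  *-distribˡ-∑ (outside ∷ E) k g = *-distribˡ-∑ E k _
  *-distribˡ-∑ (inside  ∷ E) k g = trans
    (+-cong (*-distribˡ-∑ E k _) (*-distribˡ-∑ E k _))
    (sym (distribˡ k _ _))

  -- The form of `Z̃` that survives the induction. Fixing the first element as a member of `A` turns
  -- the weight into `λ A → w (inside ∷ A)`, which need not come from a rank function: it may give
  -- the empty set rank 1.
  ∑∏ : ∀ {n} → Subset n → (Subset n → Carrier) → (Fin n → Carrier) → Carrier
  ∑∏ E w v = ∑ E (λ A _ → w A * ∏ A (λ e _ → v e))

  -- One `w` serves every `F`, because a deletion keeps the rank function. `x` takes a membership
  -- proof since u/v makes sense only on `E`.
  ∑∏-deletions : ∀ {n} (E : Subset n) → (∀ e → e ∈ E → Carrier) →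
                 (Subset n → Carrier) → (Fin n → Carrier) → Carrier
  ∑∏-deletions E x w u =
    ∑ E (λ F F⊆E → ∏ F (λ e e∈F → x e (F⊆E e∈F)) * ∑∏ (E ─ F) w u)

  ∑∏-inside : ∀ {n} (E : Subset n) w v →
              ∑∏ (inside ∷ E) w v
                ≈ ∑∏ E (λ A → w (outside ∷ A)) (λ e → v (suc e))
                  + v zero * ∑∏ E (λ A → w (inside ∷ A)) (λ e → v (suc e))
  ∑∏-inside E w v = +-congˡ (trans
    (∑-cong E λ _ _ → x∙yz≈y∙xz _ _ _)
    (*-distribˡ-∑ E _ _))

  -- If `F` avoids the first element, the deletion keeps it and `A` may use it or not:
  -- `S₀ + u zero * S₁`. If `F` contains it, it is gone from the deletion and only `S₀` remains,
  -- with the factor `x zero here`.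
  ∑∏-deletions-inside :
    ∀ {n} (E : Subset n) x w u →
    let x⁺ = λ e e∈E → x (suc e) (there e∈E)
        u⁺ = λ e → u (suc e)
        S₀ = ∑∏-deletions E x⁺ (λ A → w (outside ∷ A)) u⁺
        S₁ = ∑∏-deletions E x⁺ (λ A → w (inside ∷ A)) u⁺
    in ∑∏-deletions (inside ∷ E) x w u ≈ (S₀ + u zero * S₁) + x zero here * S₀
  ∑∏-deletions-inside E x w u = +-cong
    (begin
      ∑ E (λ F F⊆E → X F F⊆E * ∑∏ (inside ∷ (E ─ F)) w u)
        ≈⟨ ∑-cong E (λ F F⊆E → trans
             (*-congˡ (∑∏-inside (E ─ F) w u))
             (trans (distribˡ _ _ _) (+-congˡ (x∙yz≈y∙xz _ _ _)))) ⟩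
      ∑ E (λ F F⊆E → X F F⊆E * D₀ F + u zero * (X F F⊆E * D₁ F))
        ≈⟨ ∑-distrib-+ E _ _ ⟩
      ∑ E (λ F F⊆E → X F F⊆E * D₀ F)
        + ∑ E (λ F F⊆E → u zero * (X F F⊆E * D₁ F))
        ≈⟨ +-congˡ (*-distribˡ-∑ E _ _) ⟩
      ∑ E (λ F F⊆E → X F F⊆E * D₀ F)
        + u zero * ∑ E (λ F F⊆E → X F F⊆E * D₁ F)
        ∎)
    -- Here the ground set reduces to `outside ∷ (E ─ F)`, so the inner sum already is `D₀ F`.
    (trans (∑-cong E λ _ _ → *-assoc _ _ _) (*-distribˡ-∑ E _ _))
    where
    X : ∀ F → F ⊆ E → Carrier
    X F F⊆E = ∏ F (λ e e∈F → x (suc e) (there (F⊆E e∈F)))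

    D₀ D₁ : Subset _ → Carrier
    D₀ F = ∑∏ (E ─ F) (λ A → w (outside ∷ A)) (λ e → u (suc e))
    D₁ F = ∑∏ (E ─ F) (λ A → w (inside ∷ A)) (λ e → u (suc e))

  -- Division enters only through the two identities for `a` and `x`, so the induction itself is
  -- commutative ring algebra.
  ∑∏-deletion-expansion :
    ∀ {n} (E : Subset n) (a x : ∀ e → e ∈ E → Carrier)
    (w : Subset n → Carrier) (v u : Fin n → Carrier) →
    (∀ e e∈E → a e e∈E * (1# + x e e∈E) ≈ 1#) →
    (∀ e e∈E → a e e∈E * u e ≈ v e) →
    ∑∏ E w v ≈ ∏ E a * ∑∏-deletions E x w u
  ∑∏-deletion-expansion [] a x w v u a[1+x]≈1 au≈v =
    sym (trans (*-identityˡ _) (*-identityˡ _))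
  ∑∏-deletion-expansion (outside ∷ E) a x w v u a[1+x]≈1 au≈v =
    -- Neither `A` nor `F` can contain the first element, and both sides reduce to those for `E`.
    ∑∏-deletion-expansion E _ _ _ _ _
      (λ e e∈E → a[1+x]≈1 (suc e) (there e∈E))
      (λ e e∈E → au≈v (suc e) (there e∈E))
  ∑∏-deletion-expansion (inside ∷ E) a x w v u a[1+x]≈1 au≈v = begin
    ∑∏ (inside ∷ E) w v
      ≈⟨ ∑∏-inside E w v ⟩
    ∑∏ E w₀ v⁺ + v zero * ∑∏ E w₁ v⁺
      ≈⟨ +-cong (ih w₀) (*-congˡ (ih w₁)) ⟩
    P * S₀ + v zero * (P * S₁)
      -- Used from right to left: a factor 1 is inserted as `a₀ * (1# + x₀)` and `v zero` is
      -- rewritten as `a₀ * u zero`, so that `a₀ * P` can be factored out of all terms.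
      ≈⟨ +-cong
           (trans (*-congʳ (a[1+x]≈1 zero here)) (*-identityˡ _))
           (*-congʳ (au≈v zero here)) ⟨
    a₀ * (1# + x₀) * (P * S₀) + a₀ * u zero * (P * S₁)
      ≈⟨ +-congʳ (*-congʳ (trans (distribˡ _ _ _) (+-congʳ (*-identityʳ _)))) ⟩
    (a₀ + a₀ * x₀) * (P * S₀) + a₀ * u zero * (P * S₁)
      -- `x₀` is an atom here, so its subtraction stays hidden and semiring laws suffice.
      ≈⟨ solve 6 (λ a x u P S T →
           (a :+ a :* x) :* (P :* S) :+ a :* u :* (P :* T)
             := a :* P :* ((S :+ u :* T) :+ x :* S))
           refl a₀ x₀ (u zero) P S₀ S₁ ⟩
    a₀ * P * ((S₀ + u zero * S₁) + x₀ * S₀)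
      ≈⟨ *-congˡ (∑∏-deletions-inside E x w u) ⟨
    a₀ * P * ∑∏-deletions (inside ∷ E) x w u
      ∎
    where
    a₀ = a zero here
    x₀ = x zero here
    v⁺ = λ e → v (suc e)
    u⁺ = λ e → u (suc e)
    x⁺ = λ e e∈E → x (suc e) (there e∈E)
    w₀ = λ A → w (outside ∷ A)
    w₁ = λ A → w (inside ∷ A)
    P  = ∏ E (λ e e∈E → a (suc e) (there e∈E))
    S₀ = ∑∏-deletions E x⁺ w₀ u⁺
    S₁ = ∑∏-deletions E x⁺ w₁ u⁺

    ih : ∀ w′ → ∑∏ E w′ v⁺ ≈ P * ∑∏-deletions E x⁺ w′ u⁺
    ih w′ = ∑∏-deletion-expansion E _ _ w′ _ _
      (λ e e∈E → a[1+x]≈1 (suc e) (there e∈E))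
      (λ e e∈E → au≈v (suc e) (there e∈E))

  x/y*y≈x : ∀ x y (y#0 : y # 0#) → x / y [ y#0 ] * y ≈ x
  x/y*y≈x x y y#0 = begin
    x * inv y y#0 * y    ≈⟨ *-assoc _ _ _ ⟩
    x * (inv y y#0 * y)  ≈⟨ *-congˡ (*-comm _ _) ⟩
    x * (y * inv y y#0)  ≈⟨ *-congˡ (inv-inverseʳ y y#0) ⟩
    x * 1#               ≈⟨ *-identityʳ x ⟩
    x                    ∎

  x/y*y/x≈1 : ∀ x y (x#0 : x # 0#) (y#0 : y # 0#) →
              x / y [ y#0 ] * (y / x [ x#0 ]) ≈ 1#
  x/y*y/x≈1 x y x#0 y#0 = begin
    x / y [ y#0 ] * (y * inv x x#0)  ≈⟨ *-assoc _ _ _ ⟨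
    x / y [ y#0 ] * y * inv x x#0    ≈⟨ *-congʳ (x/y*y≈x x y y#0) ⟩
    x * inv x x#0                    ≈⟨ inv-inverseʳ x x#0 ⟩
    1#                               ∎

  1+[x-1]≈x : ∀ x → 1# + (x - 1#) ≈ x
  1+[x-1]≈x x = trans (sym (+-assoc _ _ _)) (xyx⁻¹≈y 1# x)

theorem3p2 :
  ∀ {c ℓ₁ ℓ₂} (K : HeytingField c ℓ₁ ℓ₂) →
  let open HeytingField K
      open Potts K
  in
  ∀ (n : ℕ) (M : Matroid n) →
  let E = Matroid.ground M in
  (q : Carrier) (q#0 : q # 0#)
  (v u : Fin n → Carrier)
  (v#0 : ∀ e → e ∈ E → v e # 0#)
  (u#0 : ∀ e → e ∈ E → u e # 0#) →
  Z̃ M q q#0 v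
    ≈ ∏ E (λ e e∈E → v e / u e [ u#0 e e∈E ])
      * ∑ E (λ F F⊆E →
          ∏ F (λ e e∈F → u e / v e [ v#0 e (F⊆E e∈F) ] - 1#)
          * Z̃ (M ∖ F) q q#0 u)
theorem3p2 K n M q q#0 v u v#0 u#0 =
  -- Both partition functions unfold to `∑∏` with the weight `inv q q#0 ^ rank A`, and `a` is v/u.
  ∑∏-deletion-expansion K (Matroid.ground M) _
    (λ e e∈E → u e / v e [ v#0 e e∈E ] - 1#) _ v u
    (λ e e∈E → trans
      -- Since 1 + x is u/v, the first identity says that v/u and u/v are inverse to each other.
      (*-congˡ (1+[x-1]≈x K _))
      (x/y*y/x≈1 K (v e) (u e) (v#0 e e∈E) (u#0 e e∈E)))
    (λ e e∈E → x/y*y≈x K (v e) (u e) (u#0 e e∈E))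
  where
  open HeytingField K
  open Potts K
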